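{- $\mathrm{ILM}\cong\mathrm{ILM}_2$, where in $\mathrm{ILM}_2$ one defines $\neg\alpha:=\alpha\rightarrow\bot$. That is, for every $\mathrm{ILM}$-formula $\alpha$, if $\alpha^{*}$ denotes the $\mathrm{ILM}_2$-formula obtained from $\alpha$ by replacing (recursively) every subformula $\neg\beta$ by $\beta\rightarrow\bot$, then $\vdash_{\mathrm{ILM}}\alpha$ if and only if $\vdash_{\mathrm{ILM}_2}\alpha^{*}$.
   Context: Two logics are equivalent ($\cong$) if they have the same language (here: after introducing $\neg$ into $\mathrm{ILM}_2$ as the stated abbreviation) and the same theorems. Formulas of $\mathrm{ILM}$ are built from propositional variables and constants $\top,\bot$ with $\wedge,\vee,\rightarrow,\neg,\sim$; $\alpha\leftrightarrow\beta$ abbreviates $(\alpha\rightarrow\beta)\wedge(\beta\rightarrow\alpha)$. Its axiom schemes are: (A1) $\alpha\rightarrow(\beta\rightarrow\alpha)$; (A2) $(\alpha\rightarrow(\beta\rightarrow\gamma))\rightarrow((\alpha\rightarrow\beta)\rightarrow(\alpha\rightarrow\gamma))$; (A3) $\alpha\rightarrow(\alpha\vee\beta)$, $\beta\rightarrow(\alpha\vee\beta)$; (A4) $(\alpha\rightarrow\gamma)\rightarrow((\beta\rightarrow\gamma)\rightarrow((\alpha\vee\beta)\rightarrow\gamma))$; (A5) $(\alpha\wedge\beta)\rightarrow\alpha$, $(\alpha\wedge\beta)\rightarrow\beta$; (A6) $(\alpha\rightarrow\beta)\rightarrow((\alpha\rightarrow\gamma)\rightarrow(\alpha\rightarrow(\beta\wedge\gamma)))$;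 (A7) $\alpha\rightarrow\top$; (A8) $\bot\rightarrow\alpha$; (A9) $(\alpha\rightarrow\beta)\rightarrow((\alpha\rightarrow\neg\beta)\rightarrow\neg\alpha)$; (A10) $\neg\alpha\rightarrow(\alpha\rightarrow\beta)$; (A11) $\sim\alpha\leftrightarrow(\alpha\rightarrow\neg\neg\sim\top)$. Modus ponens is the only rule. Formulas of $\mathrm{ILM}_2$ are built from propositional variables and constants $\top,\bot$ with $\wedge,\vee,\rightarrow,\sim$. Its axiom schemes are (A1)–(A8), (A13) $(\alpha\rightarrow\beta)\rightarrow((\alpha\rightarrow\sim\beta)\rightarrow\sim\alpha)$, and (P$'$) $\sim\sim(\sim\top\rightarrow\beta)$. Modus ponens is the only rule. -}

module Defs where

-- V is the set of propositional variables.  The superscript ᶠ marks object-level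
-- symbols that would otherwise clash with the meta-level ones.

module ILM (V : Set) where

  infixr 7 _∧_
  infixr 6 _∨_
  infixr 5 _⇒_
  infix  4 _⇔ᶠ_
  infix  8 ¬ᶠ_ ∼_
  infix  3 ⊢_

  data Formula : Set where
    var         : V → Formula
    ⊤ᶠ ⊥ᶠ       : Formula
    _∧_ _∨_ _⇒_ : Formula → Formula → Formula
    ¬ᶠ_ ∼_      : Formula → Formula

  _⇔ᶠ_ : Formula → Formula → Formula
  α ⇔ᶠ β = (α ⇒ β) ∧ (β ⇒ α)

  data Axiom : Formula → Set where
    A1  : ∀ α β → Axiom (α ⇒ (β ⇒ α))
    A2  : ∀ α β γ → Axiom ((α ⇒ (β ⇒ γ)) ⇒ ((α ⇒ β) ⇒ (α ⇒ γ)))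
    A3ˡ : ∀ α β → Axiom (α ⇒ (α ∨ β))
    A3ʳ : ∀ α β → Axiom (β ⇒ (α ∨ β))
    A4  : ∀ α β γ → Axiom ((α ⇒ γ) ⇒ ((β ⇒ γ) ⇒ ((α ∨ β) ⇒ γ)))
    A5ˡ : ∀ α β → Axiom ((α ∧ β) ⇒ α)
    A5ʳ : ∀ α β → Axiom ((α ∧ β) ⇒ β)
    A6  : ∀ α β γ → Axiom ((α ⇒ β) ⇒ ((α ⇒ γ) ⇒ (α ⇒ (β ∧ γ))))
    A7  : ∀ α → Axiom (α ⇒ ⊤ᶠ)
    A8  : ∀ α → Axiom (⊥ᶠ ⇒ α)
    A9  : ∀ α β → Axiom ((α ⇒ β) ⇒ ((α ⇒ ¬ᶠ β) ⇒ ¬ᶠ α))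
    A10 : ∀ α β → Axiom (¬ᶠ α ⇒ (α ⇒ β))
    A11 : ∀ α → Axiom (∼ α ⇔ᶠ (α ⇒ ¬ᶠ ¬ᶠ ∼ ⊤ᶠ))

  data ⊢_ : Formula → Set where
    axiom : ∀ {α} → Axiom α → ⊢ α
    mp    : ∀ {α β} → ⊢ α ⇒ β → ⊢ α → ⊢ β

module ILM₂ (V : Set) where

  infixr 7 _∧_
  infixr 6 _∨_
  infixr 5 _⇒_
  infix  8 ¬ᶠ_ ∼_
  infix  3 ⊢_

  data Formula : Set where
    var         : V → Formula
    ⊤ᶠ ⊥ᶠ       : Formula
    _∧_ _∨_ _⇒_ : Formula → Formula → Formula
    ∼_          : Formula → Formula

  ¬ᶠ_ : Formula → Formula
  ¬ᶠ α = α ⇒ ⊥ᶠ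

  data Axiom : Formula → Set where
    A1  : ∀ α β → Axiom (α ⇒ (β ⇒ α))
    A2  : ∀ α β γ → Axiom ((α ⇒ (β ⇒ γ)) ⇒ ((α ⇒ β) ⇒ (α ⇒ γ)))
    A3ˡ : ∀ α β → Axiom (α ⇒ (α ∨ β))
    A3ʳ : ∀ α β → Axiom (β ⇒ (α ∨ β))
    A4  : ∀ α β γ → Axiom ((α ⇒ γ) ⇒ ((β ⇒ γ) ⇒ ((α ∨ β) ⇒ γ)))
    A5ˡ : ∀ α β → Axiom ((α ∧ β) ⇒ α)
    A5ʳ : ∀ α β → Axiom ((α ∧ β) ⇒ β)
    A6  : ∀ α β γ → Axiom ((α ⇒ β) ⇒ ((α ⇒ γ) ⇒ (α ⇒ (β ∧ γ))))
    A7  : ∀ α → Axiom (α ⇒ ⊤ᶠ)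
    A8  : ∀ α → Axiom (⊥ᶠ ⇒ α)
    A13 : ∀ α β → Axiom ((α ⇒ β) ⇒ ((α ⇒ ∼ β) ⇒ ∼ α))
    P′  : ∀ β → Axiom (∼ ∼ (∼ ⊤ᶠ ⇒ β))

  data ⊢_ : Formula → Set where
    axiom : ∀ {α} → Axiom α → ⊢ α
    mp    : ∀ {α β} → ⊢ α ⇒ β → ⊢ α → ⊢ β

module Translation (V : Set) where

  open ILM V using (var; ⊤ᶠ; ⊥ᶠ; _∧_; _∨_; _⇒_; ∼_) renaming (¬ᶠ_ to ¬₁_)
  open ILM₂ V using (var; ⊤ᶠ; ⊥ᶠ; _∧_; _∨_; _⇒_; ∼_) renaming (¬ᶠ_ to ¬₂_)

  infix 9 _*

  -- ¬₁_ is the primitive connective of ILM, ¬₂ α abbreviates α ⇒ ⊥ᶠ in ILM₂.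
  _* : ILM.Formula V → ILM₂.Formula V
  (var p) * = var p
  ⊤ᶠ *      = ⊤ᶠ
  ⊥ᶠ *      = ⊥ᶠ
  (α ∧ β) * = α * ∧ β *
  (α ∨ β) * = α * ∨ β *
  (α ⇒ β) * = α * ⇒ β *
  (¬₁ α) *  = ¬₂ (α *)
  (∼ α) *   = ∼ (α *)

{-# OPTIONS --safe #-}
module Submission where

open import Data.List.Base using (List; []; _∷_)
open import Data.List.Membership.Propositional using (_∈_)
open import Data.List.Relation.Unary.Any using (here; there)
open import Data.Product.Base using (_×_; _,_; proj₂)
open import Function.Bundles using (_⇔_; mk⇔)
open import Relation.Binary.PropositionalEquality.Core using (refl)
open import Defs

-- Write f for ∼ ⊤.  In ILM₂, A13 makes ∼ α equivalent to α → f, so P′ at β = ⊥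
-- reads (¬ f → f) → f, which is stability of f: ¬ ¬ f → f; hence A11.  Conversely,
-- A11 turns ∼ ∼ (f → β) into ((f → β) → ¬ ¬ f) → ¬ ¬ f, which holds because ¬ f
-- yields f → β.  For the converse direction of the theorem, ILM₂ is embedded in
-- ILM by e, and α is ILM-equivalent to e (α *) since ¬ α ↔ (α → ⊥) is provable in ILM.

module Deduction
  {F : Set} (_⇒_ : F → F → F) (⊢_ : F → Set)
  (k : ∀ α β → ⊢ (α ⇒ (β ⇒ α)))
  (s : ∀ α β γ → ⊢ ((α ⇒ (β ⇒ γ)) ⇒ ((α ⇒ β) ⇒ (α ⇒ γ))))
  (mp : ∀ {α β} → ⊢ (α ⇒ β) → ⊢ α → ⊢ β)
  where

  infix  3 _⊩_
  infixl 9 _·_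

  -- Axioms enter only through `thm`, and the Hilbert system is a parameter, so both logics share
  -- one deduction theorem.
  data _⊩_ (Γ : List F) : F → Set where
    hyp : ∀ {α} → α ∈ Γ → Γ ⊩ α
    thm : ∀ {α} → ⊢ α → Γ ⊩ α
    _·_ : ∀ {α β} → Γ ⊩ α ⇒ β → Γ ⊩ α → Γ ⊩ β

  id-thm : ∀ α → ⊢ (α ⇒ α)
  id-thm α = mp (mp (s α (α ⇒ α) α) (k α (α ⇒ α))) (k α α)

  deduction : ∀ {Γ α β} → α ∷ Γ ⊩ β → Γ ⊩ α ⇒ β
  deduction {α = α}         (hyp (here refl)) = thm (id-thm α)
  deduction {α = α} {β = β} (hyp (there i)) = thm (k β α) · hyp i
  deduction {α = α} {β = β} (thm p) = thm (mp (k β α) p)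
  deduction {α = α} {β = β} (_·_ {α = γ} d e) = thm (s α γ β) · deduction d · deduction e

  closed : ∀ {α} → [] ⊩ α → ⊢ α
  closed (thm p) = p
  closed (d · e) = mp (closed d) (closed e)

  h₀ : ∀ {Γ α} → α ∷ Γ ⊩ α
  h₀ = hyp (here refl)

  h₁ : ∀ {Γ α β} → β ∷ α ∷ Γ ⊩ α
  h₁ = hyp (there (here refl))

  h₂ : ∀ {Γ α β γ} → γ ∷ β ∷ α ∷ Γ ⊩ α
  h₂ = hyp (there (there (here refl)))

module ILMProperties (V : Set) where

  open ILM V

  open Deduction _⇒_ ⊢_ (λ α β → axiom (A1 α β)) (λ α β γ → axiom (A2 α β γ)) mp public

  explosion : ∀ {Γ α β} → Γ ⊩ ¬ᶠ α → Γ ⊩ α → Γ ⊩ β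
  explosion d e = thm (axiom (A10 _ _)) · d · e

  -- This is A9 with `⊥ᶠ` as the contradicted formula; its second premise reuses `d`, since `⊥ᶠ`
  -- implies `¬ᶠ ⊥ᶠ` by A8.
  ¬-intro : ∀ {Γ α} → α ∷ Γ ⊩ ⊥ᶠ → Γ ⊩ ¬ᶠ α
  ¬-intro {α = α} d =
    thm (axiom (A9 α ⊥ᶠ)) · deduction d · deduction (thm (axiom (A8 (¬ᶠ ⊥ᶠ))) · d)

  ∼-elim : ∀ {Γ α} → Γ ⊩ ∼ α → Γ ⊩ α → Γ ⊩ ¬ᶠ ¬ᶠ ∼ ⊤ᶠ
  ∼-elim {α = α} d e = thm (mp (axiom (A5ˡ _ _)) (axiom (A11 α))) · d · e

  ∼-intro : ∀ {Γ α} → α ∷ Γ ⊩ ¬ᶠ ¬ᶠ ∼ ⊤ᶠ → Γ ⊩ ∼ α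
  ∼-intro {α = α} d = thm (mp (axiom (A5ʳ _ _)) (axiom (A11 α))) · deduction d

  A13-thm : ∀ α β → ⊢ (α ⇒ β) ⇒ ((α ⇒ ∼ β) ⇒ ∼ α)
  A13-thm α β = closed (deduction (deduction (∼-intro (∼-elim (h₁ · h₀) (h₂ · h₀)))))

  P′-thm : ∀ β → ⊢ ∼ ∼ (∼ ⊤ᶠ ⇒ β)
  P′-thm β = closed (∼-intro (¬-intro
    -- The context is `∼ (f ⇒ β)` and `¬ f`. The inner `explosion` builds `f ⇒ β`, so `∼-elim`
    -- yields `¬ ¬ f` against `¬ f`.
    (explosion (∼-elim h₁ (deduction (explosion h₁ h₀))) h₀)))

  ∧-mono : ∀ {α α′ β β′} → ⊢ α ⇒ α′ → ⊢ β ⇒ β′ → ⊢ (α ∧ β) ⇒ (α′ ∧ β′)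
  ∧-mono p q = mp (mp (axiom (A6 _ _ _))
    (closed (deduction (thm p · (thm (axiom (A5ˡ _ _)) · h₀)))))
    (closed (deduction (thm q · (thm (axiom (A5ʳ _ _)) · h₀))))

  ∨-mono : ∀ {α α′ β β′} → ⊢ α ⇒ α′ → ⊢ β ⇒ β′ → ⊢ (α ∨ β) ⇒ (α′ ∨ β′)
  ∨-mono p q = mp (mp (axiom (A4 _ _ _))
    (closed (deduction (thm (axiom (A3ˡ _ _)) · (thm p · h₀)))))
    (closed (deduction (thm (axiom (A3ʳ _ _)) · (thm q · h₀))))

  ⇒-mono : ∀ {α α′ β β′} → ⊢ α′ ⇒ α → ⊢ β ⇒ β′ → ⊢ (α ⇒ β) ⇒ (α′ ⇒ β′)
  ⇒-mono p q = closed (deduction (deduction (thm q · (h₁ · (thm p · h₀)))))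

  ∼-antitone : ∀ {α α′} → ⊢ α′ ⇒ α → ⊢ ∼ α ⇒ ∼ α′
  ∼-antitone p = closed (deduction (∼-intro (∼-elim h₁ (thm p · h₀))))

  -- Antitonicity is merged with the passage from primitive `¬ᶠ` to implication into `⊥ᶠ`, the form
  -- that `e` gives to a translated negation.
  ¬⇒⊥ : ∀ {α α′} → ⊢ α′ ⇒ α → ⊢ ¬ᶠ α ⇒ (α′ ⇒ ⊥ᶠ)
  ¬⇒⊥ p = closed (deduction (deduction (explosion h₁ (thm p · h₀))))

  ⊥⇒¬ : ∀ {α α′} → ⊢ α′ ⇒ α → ⊢ (α ⇒ ⊥ᶠ) ⇒ ¬ᶠ α′
  ⊥⇒¬ p = closed (deduction (¬-intro (h₁ · (thm p · h₀))))

module ILM₂Properties (V : Set) where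

  open ILM₂ V

  open Deduction _⇒_ ⊢_ (λ α β → axiom (A1 α β)) (λ α β γ → axiom (A2 α β γ)) mp public

  ⊤-intro : ∀ {Γ} → Γ ⊩ ⊤ᶠ
  ⊤-intro = thm (mp (axiom (A7 (⊥ᶠ ⇒ ⊥ᶠ))) (axiom (A8 ⊥ᶠ)))

  ex-falso : ∀ {Γ α} → Γ ⊩ ⊥ᶠ → Γ ⊩ α
  ex-falso d = thm (axiom (A8 _)) · d

  ∧-intro : ∀ {α β} → ⊢ α → ⊢ β → ⊢ α ∧ β
  -- A6 only joins consequents of a common antecedent; `⊤ᶠ` serves as that antecedent and is then
  -- discharged.
  ∧-intro p q = closed (thm (axiom (A6 ⊤ᶠ _ _))
    · deduction (thm p) · deduction (thm q) · ⊤-intro)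

  ∼-intro : ∀ {Γ α} → α ∷ Γ ⊩ ∼ ⊤ᶠ → Γ ⊩ ∼ α
  ∼-intro d = thm (axiom (A13 _ ⊤ᶠ)) · thm (axiom (A7 _)) · deduction d

  -- A13 negates the common antecedent of its premises; choosing `⊤ᶠ` there, with `e` and `d` made
  -- constant implications by A1, yields `∼ ⊤ᶠ`.
  ∼-elim : ∀ {Γ α} → Γ ⊩ ∼ α → Γ ⊩ α → Γ ⊩ ∼ ⊤ᶠ
  ∼-elim {α = α} d e = thm (axiom (A13 ⊤ᶠ α))
    · (thm (axiom (A1 _ _)) · e) · (thm (axiom (A1 _ _)) · d)

  ∼⊤-stable : ∀ {Γ} → Γ ⊩ ¬ᶠ ¬ᶠ ∼ ⊤ᶠ → Γ ⊩ ∼ ⊤ᶠ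
  -- From `¬ ¬ f`, `∼ ¬ f` follows by ex falso, and P′ supplies `∼ ∼ ¬ f`. Applying the finished
  -- implication to `d` spares weakening `d`.
  ∼⊤-stable d = deduction (∼-elim (thm (axiom (P′ ⊥ᶠ))) (∼-intro (ex-falso (h₁ · h₀)))) · d

  A9-thm : ∀ α β → ⊢ (α ⇒ β) ⇒ ((α ⇒ ¬ᶠ β) ⇒ ¬ᶠ α)
  A9-thm α β = closed (deduction (deduction (deduction (h₁ · h₀ · (h₂ · h₀)))))

  A10-thm : ∀ α β → ⊢ ¬ᶠ α ⇒ (α ⇒ β)
  A10-thm α β = closed (deduction (deduction (ex-falso (h₁ · h₀))))

  -- Forward, `∼ α` and `α` give `f`, hence `¬ ¬ f`; the backward half rests on stability of `f`.
  -- The biconditional is spelled out as the translation of A11 computes it.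
  A11-thm : ∀ α → ⊢ (∼ α ⇒ (α ⇒ ¬ᶠ ¬ᶠ ∼ ⊤ᶠ)) ∧ ((α ⇒ ¬ᶠ ¬ᶠ ∼ ⊤ᶠ) ⇒ ∼ α)
  A11-thm α = ∧-intro
    (closed (deduction (deduction (deduction (h₀ · ∼-elim h₂ h₁)))))
    (closed (deduction (∼-intro (∼⊤-stable (h₁ · h₀)))))

module Equivalence (V : Set) where

  open Translation V using (_*)
  open ILM V hiding (_⇔ᶠ_)
  open ILM₂ V using (var; ⊤ᶠ; ⊥ᶠ; _∧_; _∨_; _⇒_; ∼_; A1; A2; A3ˡ; A3ʳ; A4; A5ˡ; A5ʳ; A6;
                     A7; A8; A13; P′; axiom; mp)
    renaming (Formula to Formula₂; Axiom to Axiom₂; ⊢_ to ⊢₂_)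
  open ILMProperties V using (id-thm; A13-thm; P′-thm; ∧-mono; ∨-mono; ⇒-mono; ∼-antitone;
                              ¬⇒⊥; ⊥⇒¬)
  open ILM₂Properties V using (A9-thm; A10-thm; A11-thm)

  *-axiom : ∀ {α} → Axiom α → ⊢₂ α *
  *-axiom (A1 α β)   = axiom (A1 _ _)
  *-axiom (A2 α β γ) = axiom (A2 _ _ _)
  *-axiom (A3ˡ α β)  = axiom (A3ˡ _ _)
  *-axiom (A3ʳ α β)  = axiom (A3ʳ _ _)
  *-axiom (A4 α β γ) = axiom (A4 _ _ _)
  *-axiom (A5ˡ α β)  = axiom (A5ˡ _ _)
  *-axiom (A5ʳ α β)  = axiom (A5ʳ _ _)
  *-axiom (A6 α β γ) = axiom (A6 _ _ _)
  *-axiom (A7 α)     = axiom (A7 _)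
  *-axiom (A8 α)     = axiom (A8 _)
  *-axiom (A9 α β)   = A9-thm _ _
  *-axiom (A10 α β)  = A10-thm _ _
  *-axiom (A11 α)    = A11-thm _

  *-sound : ∀ {α} → ⊢ α → ⊢₂ α *
  *-sound (axiom a) = *-axiom a
  *-sound (mp p q)  = mp (*-sound p) (*-sound q)

  e : Formula₂ → Formula
  e (var p) = var p
  e ⊤ᶠ      = ⊤ᶠ
  e ⊥ᶠ      = ⊥ᶠ
  e (α ∧ β) = e α ∧ e β
  e (α ∨ β) = e α ∨ e β
  e (α ⇒ β) = e α ⇒ e β
  e (∼ α)   = ∼ e α

  e-axiom : ∀ {α} → Axiom₂ α → ⊢ e α
  e-axiom (A1 α β)   = axiom (A1 _ _)
  e-axiom (A2 α β γ) = axiom (A2 _ _ _)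
  e-axiom (A3ˡ α β)  = axiom (A3ˡ _ _)
  e-axiom (A3ʳ α β)  = axiom (A3ʳ _ _)
  e-axiom (A4 α β γ) = axiom (A4 _ _ _)
  e-axiom (A5ˡ α β)  = axiom (A5ˡ _ _)
  e-axiom (A5ʳ α β)  = axiom (A5ʳ _ _)
  e-axiom (A6 α β γ) = axiom (A6 _ _ _)
  e-axiom (A7 α)     = axiom (A7 _)
  e-axiom (A8 α)     = axiom (A8 _)
  e-axiom (A13 α β)  = A13-thm _ _
  e-axiom (P′ β)     = P′-thm _

  e-sound : ∀ {α} → ⊢₂ α → ⊢ e α
  e-sound (axiom a) = e-axiom a
  e-sound (mp p q)  = mp (e-sound p) (e-sound q)

  -- `e (α *)` rewrites each `¬ᶠ` in `α`, so the comparison is by provable implication. Both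
  -- directions go together because `⇒`, `¬ᶠ` and `∼` swap them.
  e-* : ∀ α → (⊢ α ⇒ e (α *)) × (⊢ e (α *) ⇒ α)
  e-* (var p) = id-thm _ , id-thm _
  e-* ⊤ᶠ      = id-thm _ , id-thm _
  e-* ⊥ᶠ      = id-thm _ , id-thm _
  e-* (α ∧ β) = let (p , p⁻) = e-* α; (q , q⁻) = e-* β in ∧-mono p q , ∧-mono p⁻ q⁻
  e-* (α ∨ β) = let (p , p⁻) = e-* α; (q , q⁻) = e-* β in ∨-mono p q , ∨-mono p⁻ q⁻
  e-* (α ⇒ β) = let (p , p⁻) = e-* α; (q , q⁻) = e-* β in ⇒-mono p⁻ q , ⇒-mono p q⁻
  e-* (¬ᶠ α)  = let (p , p⁻) = e-* α in ¬⇒⊥ p⁻ , ⊥⇒¬ p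
  e-* (∼ α)   = let (p , p⁻) = e-* α in ∼-antitone p⁻ , ∼-antitone p

  *-complete : ∀ α → ⊢₂ α * → ⊢ α
  *-complete α d = mp (proj₂ (e-* α)) (e-sound d)

theorem3p13 : (V : Set) (α : ILM.Formula V) →
    ILM.⊢_ V α ⇔ ILM₂.⊢_ V (Translation._* V α)
theorem3p13 V α = mk⇔ *-sound (*-complete α)
  where open Equivalence V
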